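{- The map $f$ defined below restricts to a bijection from $\mathcal{G}_1$ onto $\mathcal{A}_1$, and $f(\pi)$ is a partition of the same integer as $\pi$.
   Context: Partitions are nonincreasing finite sequences of positive integers; $m_j(\pi)$ is the multiplicity of $j$ in $\pi$, $\ell(\pi)$ the number of parts, and $\pi\cup\lambda$ the partition formed by all parts of both (as a multiset). $\langle a^{m}\rangle$ denotes the partition consisting of $m$ copies of $a$. $\mathcal{G}_2$ is the set of partitions $\pi$ with $m_1(\pi)\le 1$ and $m_j(\pi)+m_{j+1}(\pi)\le 2$ for all $j\ge1$. $\mathcal{G}_1$ is the set of partitions $\pi$ with $m_1(\pi)=0$ and $m_j(\pi)+m_{j+1}(\pi)\le 2$ for all $j\ge1$ (so $\mathcal G_1\subset\mathcal G_2$). For $\pi\in\mathcal{G}_2$ every part has multiplicity at most $2$. Let $D(\pi)$ be the number of distinct parts of multiplicity $2$, let $R_1(\pi)>R_2(\pi)>\dots>R_{D(\pi)}(\pi)$ be these parts, and set $R_{D(\pi)+1}(\pi)=0$, $R_0(\pi)=\infty$. For $0\le k\le D(\pi)$ let $\pi^{(k)}$ be the partition consisting of the parts of $\pi$ strictly between $R_{k+1}(\pi)$ and $R_k(\pi)$ (these parts are distinct). For a partition $\mu$ and integer $c$, $\mu+\langle c^{\ell(\mu)}\rangle$ denotes $\mu$ with $c$ added to each part. Define $$f(\pi)=\bigcup_{i=1}^{D(\pi)}\big\langle (2i)^{R_i(\pi)-R_{i+1}(\pi)-\ell(\pi^{(i)})}\big\rangle\ \cup\ \bigcup_{i=0}^{D(\pi)}\Big(\pi^{(i)}+\langle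 (2i)^{\ell(\pi^{(i)})}\rangle\Big).$$ For a partition $\lambda$, $R_1(\lambda)$ is its largest part of multiplicity $\ge2$ (or $0$ if none). $\mathcal{A}_1$ is the set of partitions $\lambda$ such that $m_j(\lambda)\le1$ for odd $j$, $m_j(\lambda)=0$ for odd $j<R_1(\lambda)+2$, and $m_j(\lambda)\ge 2$ for even $j$ with $0<j<R_1(\lambda)$. -}

module Defs where

open import Data.List.Base
  using (List; []; _∷_; length; map; filter; foldr; replicate; upTo; deduplicate; _++_)
open import Data.List.Relation.Unary.All using (All; [])
import Data.List.Relation.Unary.All as All
import Data.List.Relation.Unary.All.Properties as All
open import Data.List.Relation.Unary.Linked using (Linked; [])
import Data.List.Relation.Unary.Linked as Linked
import Data.List.Relation.Unary.Linked.Properties as Linked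
open import Data.List.Relation.Binary.Permutation.Propositional using (↭-sym)
open import Data.List.Relation.Binary.Permutation.Propositional.Properties using (All-resp-↭)
open import Data.Nat.Base
open import Data.Nat.ListAction using (sum)
open import Data.Nat.Divisibility using (_∣_; _∤_)
open import Data.Nat.Properties
open import Data.Product using (Σ-syntax; ∃; _×_; _,_; proj₁)
open import Data.Unit using (⊤)
open import Function.Definitions using (Bijective)
open import Level using (0ℓ)
open import Relation.Binary.Core using (Rel)
open import Relation.Binary.PropositionalEquality using (_≡_)
import Relation.Binary.Construct.Flip.Ord as Flip
open import Relation.Nullary.Decidable using (yes)
open import Relation.Unary using (Pred; Decidable)
open import Relation.Unary.Properties using (_∩?_)

open import Data.List.Sort (Flip.decTotalOrder ≤-decTotalOrder)
  using (sort; sort-↭; sort-↗)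

-- Both proof fields are propositions (Linked.irrelevant, All.irrelevant), so
-- _≡_ on partitions is equality of the lists of parts.
record Partition : Set where
  constructor mkPartition
  field
    parts         : List ℕ
    nonincreasing : Linked _≥_ parts
    positive      : All (0 <_) parts

open Partition public

infix 8 ∣_∣
∣_∣ : Partition → ℕ
∣ π ∣ = sum (parts π)

ℓ : Partition → ℕ
ℓ π = length (parts π)

m : ℕ → Partition → ℕ
m j π = length (filter (_≟ j) (parts π))

∅ : Partition
∅ = mkPartition [] [] []

infixr 6 _∪_
_∪_ : Partition → Partition → Partition
π ∪ μ = record
  { parts         = sort (parts π ++ parts μ)
  ; nonincreasing = sort-↗ (parts π ++ parts μ)
  ; positive      = All-resp-↭ (↭-sym (sort-↭ (parts π ++ parts μ)))
                      (All.++⁺ (positive π) (positive μ))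
  }

-- ⋃ n μ = μ 0 ∪ … ∪ μ (n - 1)
⋃ : ℕ → (ℕ → Partition) → Partition
⋃ n μ = foldr _∪_ ∅ (map μ (upTo n))

⟨_^_⟩ : (a : ℕ) .{{_ : NonZero a}} → ℕ → Partition
⟨ a ^ n ⟩ = record
  { parts         = replicate n a
  ; nonincreasing = constant n
  ; positive      = All.replicate⁺ n (>-nonZero⁻¹ a)
  }
  where
  constant : ∀ k → Linked _≥_ (replicate k a)
  constant zero          = []
  constant (suc zero)    = Linked.[-]
  constant (suc (suc k)) = ≤-refl Linked.∷ constant (suc k)

-- μ +⟨ c ⟩ is μ + ⟨ c ^ ℓ μ ⟩, i.e. c is added to every part of μ.
infixl 7 _+⟨_⟩
_+⟨_⟩ : Partition → ℕ → Partition
μ +⟨ c ⟩ = record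
  { parts         = map (_+ c) (parts μ)
  ; nonincreasing = Linked.map⁺ (Linked.map (+-monoˡ-≤ c) (nonincreasing μ))
  ; positive      = All.map⁺ (All.map (λ {x} 0<x → ≤-trans 0<x (m≤m+n x c)) (positive μ))
  }

select : {P : Pred ℕ 0ℓ} → Decidable P → Partition → Partition
select P? π = record
  { parts         = filter P? (parts π)
  ; nonincreasing = Linked.filter⁺ P? (λ x≥y y≥z → ≤-trans y≥z x≥y) (nonincreasing π)
  ; positive      = All.filter⁺ P? (positive π)
  }

G₁ : Pred Partition 0ℓ
G₁ π = m 1 π ≡ 0 × (∀ j → 1 ≤ j → m j π + m (suc j) π ≤ 2)

G₂ : Pred Partition 0ℓ
G₂ π = m 1 π ≤ 1 × (∀ j → 1 ≤ j → m j π + m (suc j) π ≤ 2)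

-- In decreasing order, since deduplicate and filter keep the order of parts π.
doubleParts : Partition → List ℕ
doubleParts π = filter (λ j → m j π ≟ 2) (deduplicate _≟_ (parts π))

D : Partition → ℕ
D π = length (doubleParts π)

nth : List ℕ → ℕ → ℕ
nth []       _       = 0
nth (x ∷ xs) zero    = x
nth (x ∷ xs) (suc i) = nth xs i

-- R π i is Rᵢ(π) for i ≥ 1; the default value of nth gives R π (D π + 1) = 0.
R : Partition → (i : ℕ) .{{_ : NonZero i}} → ℕ
R π (suc i) = nth (doubleParts π) i

-- BelowR π i x is x < Rᵢ(π), where R₀(π) = ∞.
BelowR : Partition → ℕ → Pred ℕ 0ℓ
BelowR π zero    x = ⊤
BelowR π (suc i) x = x < R π (suc i)

belowR? : ∀ π i → Decidable (BelowR π i)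
belowR? π zero    x = yes _
belowR? π (suc i) x = x <? R π (suc i)

-- block π k is π⁽ᵏ⁾.
block : Partition → ℕ → Partition
block π k = select ((R π (suc k) <?_) ∩? belowR? π k) π

-- The index i of the first union runs over 1 ≤ i ≤ D π, written i = suc k.
-- The map is intended on G₂ only. There the parts of block π i are distinct and
-- lie strictly between R π (suc i) and R π i, so the exponent is never truncated.
f : Partition → Partition
f π =
    ⋃ (D π) (λ k → ⟨ 2 * suc k ^ R π (suc k) ∸ R π (suc (suc k)) ∸ ℓ (block π (suc k)) ⟩)
  ∪ ⋃ (suc (D π)) (λ i → block π i +⟨ 2 * i ⟩)

largestRepeated : Partition → ℕ
largestRepeated π = foldr _⊔_ 0 (filter (λ j → 2 ≤? m j π) (parts π))

A₁ : Pred Partition 0ℓ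
A₁ π =
    (∀ j → 2 ∤ j → m j π ≤ 1)
  × (∀ j → 2 ∤ j → j < largestRepeated π + 2 → m j π ≡ 0)
  × (∀ j → 2 ∣ j → 0 < j → j < largestRepeated π → 2 ≤ m j π)

-- P and Q need not be proof-irrelevant, so elements of ∃ P and ∃ Q are compared
-- by their first components.
RestrictsToBijection : {A B : Set} → (A → B) → Pred A 0ℓ → Pred B 0ℓ → Set
RestrictsToBijection {A} {B} g P Q =
  Σ[ maps ∈ (∀ {x} → P x → Q (g x)) ] Bijective _≈_ _≈_ (restriction maps)
  where
  _≈_ : {C : Set} {S : Pred C 0ℓ} → Rel (∃ S) 0ℓ
  x ≈ y = proj₁ x ≡ proj₁ y

  restriction : (∀ {x} → P x → Q (g x)) → ∃ P → ∃ Q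
  restriction maps (x , px) = g x , maps px

{-# OPTIONS --safe #-}
module Submission where

-- Read π ∈ 𝒢₂ as a word over its positions 1, 2, 3, …. A double part is
-- surrounded by absent values, so it can be deleted together with the absent
-- value above it, leaving a mark on the absent value below. Deleting all D
-- double parts and starting at position 2D + 1 turns the single parts into the
-- distinct parts of f π beyond 2D, and the exponent of 2i is one more than
-- the number of values absent from π between Rᵢ₊₁ and Rᵢ. In f π every even
-- value up to 2D is therefore repeated and nothing beyond 2D is.
-- Conversely the multiplicities of 2, 4, …, 2D, all at least 2, say on which
-- absent values to put the marks.

open import Defs
open import Data.Bool.Base using (Bool; true; false; if_then_else_)
open import Data.Empty using (⊥)
open import Data.List.Base
  using (List; []; _∷_; _++_; length; map; filter; foldr; replicate;
         applyUpTo; applyDownFrom; concat; deduplicate)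
open import Data.List.Properties
  using (filter-accept; filter-reject; filter-none; filter-all; filter-++; length-++;
         length-replicate; length-applyUpTo; length-applyDownFrom; ∷-injectiveʳ)
open import Data.List.Membership.Propositional using () renaming (_∈_ to _∈ˡ_)
open import Data.List.Membership.Propositional.Properties using (∈-∃++; ∈-filter⁺)
open import Data.List.Relation.Unary.All as All using (All; []; _∷_)
import Data.List.Relation.Unary.All.Properties as All
open import Data.List.Relation.Unary.Any using (here; there)
open import Data.List.Relation.Unary.Linked as Linked using (Linked; []; [-]; _∷_)
open import Data.List.Relation.Binary.Permutation.Propositional
  using (_↭_; ↭-refl; ↭-sym; ↭-trans; ↭-reflexive; prep; ↭⇒↭ₛ)
open import Data.List.Relation.Binary.Permutation.Propositional.Properties
  using (filter-↭; ↭-length; shift; ++⁺; ++⁺ˡ)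
import Data.List.Relation.Unary.Sorted.TotalOrder.Properties as Sorted
import Data.List.Relation.Binary.Permutation.Homogeneous as Homogeneous
open import Data.List.Relation.Binary.Pointwise as Pointwise using (Pointwise-≡⇒≡)
open import Data.Nat.Base
open import Data.Nat.Divisibility using (_∣_; _∤_; divides; m∣m*n; _∣?_; _∣0; ∣m+n∣m⇒∣n; >⇒∤)
open import Data.Nat.ListAction using (sum)
open import Data.Nat.ListAction.Properties using (sum-↭; sum-++)
open import Data.Nat.Properties
open import Data.Nat.Tactic.RingSolver using (solve-∀)
open import Data.Product using (Σ-syntax; _×_; _,_; proj₁; proj₂)
open import Data.Sum.Base using (_⊎_; inj₁; inj₂)
open import Data.Unit using (⊤; tt)
open import Function.Base using (_∘_; id)
open import Level using (0ℓ)
open import Relation.Binary.PropositionalEquality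
open import Relation.Nullary using (¬_; yes; no; contradiction; ¬?)
open import Relation.Unary using (_∈_; Pred; Decidable)
open import Relation.Unary.Properties using (_∩?_)
import Relation.Binary.Construct.Flip.Ord as Flip
open import Data.List.Sort (Flip.decTotalOrder ≤-decTotalOrder) using (sort-↭)

-- The exponent of 2k plus ℓ(π⁽ᵏ⁾) is Rₖ - Rₖ₊₁. Hence exactly Rᵢ parts of f π come from the levels
-- k ≥ i, and the two copies of Rᵢ are spent on raising each of them by 2. This is why the size is
-- preserved. In 𝒢₂ the value below a double part exists and is absent. So every exponent is at
-- least 2, and position 1 survives the deletion as the lowest position: 1 is a part of π exactly
-- when 2D + 1 is a part of f π. This is how m₁ = 0 turns into the bound R₁ + 2 on odd parts in 𝒜₁.
-- Decoding is unambiguous because the height of a word and its number of gaps are functions of the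
-- remaining bits and exponents, and together these reveal whether a double part is on top. Absent
-- values on top of a word do not change the partition, so one partition has many words; words are
-- therefore compared through `values`.

-- Multiplicities and partitions as multisets

count : ℕ → List ℕ → ℕ
count j xs = length (filter (_≟ j) xs)

count-≡ : ∀ j xs → count j (j ∷ xs) ≡ suc (count j xs)
count-≡ j xs = cong length (filter-accept (_≟ j) refl)

count-≢ : ∀ {x j} → x ≢ j → ∀ xs → count j (x ∷ xs) ≡ count j xs
count-≢ {j = j} x≢j xs = cong length (filter-reject (_≟ j) x≢j)

count-∷-≤ : ∀ j x xs → count j xs ≤ count j (x ∷ xs)
count-∷-≤ j x xs with x ≟ j
... | yes refl = ≤-trans (n≤1+n _) (≤-reflexive (sym (count-≡ x xs)))
... | no  x≢j  = ≤-reflexive (sym (count-≢ x≢j xs))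

count-++ : ∀ j xs ys → count j (xs ++ ys) ≡ count j xs + count j ys
count-++ j xs ys = trans (cong length (filter-++ (_≟ j) xs ys)) (length-++ (filter (_≟ j) xs))

count-↭ : ∀ j {xs ys} → xs ↭ ys → count j xs ≡ count j ys
count-↭ j p = ↭-length (filter-↭ (_≟ j) p)

count-absent : ∀ {j xs} → All (_≢ j) xs → count j xs ≡ 0
count-absent {j} ps = cong length (filter-none (_≟ j) ps)

count-replicate : ∀ j n → count j (replicate n j) ≡ n
count-replicate j n =
  trans (cong length (filter-all (_≟ j) (All.replicate⁺ n refl))) (length-replicate n)

count-positive⇒∈ : ∀ j xs → 0 < count j xs → j ∈ˡ xs
count-positive⇒∈ j (x ∷ xs) p with x ≟ j
... | yes refl = here refl
... | no  x≢j  = there (count-positive⇒∈ j xs (subst (0 <_) (count-≢ x≢j xs) p))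

count-∷-cancel : ∀ x xs ys → (∀ j → count j (x ∷ xs) ≡ count j (x ∷ ys)) → ∀ j → count j xs ≡ count j ys
count-∷-cancel x xs ys eq j = +-cancelˡ-≡ (count j (x ∷ [])) _ _
  (trans (sym (count-++ j (x ∷ []) xs)) (trans (eq j) (count-++ j (x ∷ []) ys)))

counts⇒↭ : ∀ xs ys → (∀ j → count j xs ≡ count j ys) → xs ↭ ys
counts⇒↭ []       []       eq = ↭-refl
counts⇒↭ []       (y ∷ ys) eq = contradiction (trans (eq y) (count-≡ y ys)) λ ()
counts⇒↭ (x ∷ xs) ys       eq
  with us , vs , refl ← ∈-∃++ (count-positive⇒∈ x ys
         (subst (0 <_) (trans (sym (count-≡ x xs)) (eq x)) z<s)) =
  ↭-trans
    (prep x (counts⇒↭ xs (us ++ vs) (count-∷-cancel x xs (us ++ vs)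
      (λ j → trans (eq j) (count-↭ j (shift x us vs))))))
    (↭-sym (shift x us vs))

partition-≡ : ∀ {π μ} → parts π ≡ parts μ → π ≡ μ
partition-≡ {mkPartition xs p q} {mkPartition _ p′ q′} refl =
  cong₂ (mkPartition xs) (Linked.irrelevant ≤-irrelevant p p′) (All.irrelevant ≤-irrelevant q q′)

-- A sorted list is determined by its multiset, so identities about `f` can be proved up to
-- permutation, past the `sort` hidden in every union.
partition-↭ : ∀ {π μ} → parts π ↭ parts μ → π ≡ μ
partition-↭ {π} {μ} p = partition-≡ (Pointwise-≡⇒≡
  (Pointwise.map sym (Sorted.↗↭↗⇒≋ (Flip.totalOrder ≤-totalOrder)
    (nonincreasing π) (nonincreasing μ) (Homogeneous.map sym (↭⇒↭ₛ p)))))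

-- Words and their statistics

-- A word lists the positions 1, 2, 3, … of a partition in 𝒢₂ from the largest
-- one down to 1: a part of multiplicity 1, an absent value, or a part of
-- multiplicity 2 together with the absent value above it.
data Word : Set
-- The absent value below a double part may be a plain one or the one that a lower double part
-- carries on top. At position 1 there is none, which excludes a repeated 1.
Gapped : Word → Set

data Word where
  end    : Word
  single : Word → Word
  skip   : Word → Word
  double : (w : Word) → Gapped w → Word

Gapped end          = ⊥
Gapped (single w)   = ⊥
Gapped (skip w)     = ⊤
Gapped (double w _) = ⊤

-- The first position above the word.
height : Word → ℕ
height end          = 1
height (single w)   = suc (height w)
height (skip w)     = suc (height w)
height (double w _) = 2 + height w

values : Word → List ℕ
values end          = []
values (single w)   = height w ∷ values w
values (skip w)     = values w
values (double w _) = height w ∷ height w ∷ values w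

doubles : Word → List ℕ
doubles end          = []
doubles (single w)   = doubles w
doubles (skip w)     = doubles w
doubles (double w _) = height w ∷ doubles w

blocks : Word → ℕ → List ℕ
blocks end          k       = []
blocks (single w)   zero    = height w ∷ blocks w zero
blocks (single w)   (suc k) = blocks w (suc k)
blocks (skip w)     k       = blocks w k
blocks (double w _) zero    = []
blocks (double w _) (suc k) = blocks w k

-- The number of absent values above the topmost double part; position 0 counts
-- as absent when there is no double part.
gaps : Word → ℕ
gaps end          = 1
gaps (single w)   = gaps w
gaps (skip w)     = suc (gaps w)
gaps (double w _) = 2

-- exps w lists the exponents Rᵢ − Rᵢ₊₁ − ℓ(π⁽ⁱ⁾), i = 1, …, D.
exps : Word → List ℕ
exps end          = []
exps (single w)   = exps w
exps (skip w)     = exps w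
exps (double w _) = gaps w ∷ exps w

bits : Word → List Bool
bits end          = []
bits (single w)   = true ∷ bits w
bits (skip w)     = false ∷ bits w
bits (double w _) = bits w

evens : ℕ → List ℕ → List ℕ
evens c []       = []
evens c (e ∷ es) = replicate e (2 * suc c) ++ evens (suc c) es

singles : ℕ → List Bool → List ℕ
singles c []           = []
singles c (true ∷ bs)  = suc (length bs + c) ∷ singles c bs
singles c (false ∷ bs) = singles c bs

-- The parts of f π when π is given by w.
image : Word → List ℕ
image w = evens 0 (exps w) ++ singles (2 * length (exps w)) (bits w)

0<height : ∀ w → 0 < height w
0<height end          = z<s
0<height (single w)   = z<s
0<height (skip w)     = z<s
0<height (double w _) = z<s

values<height : ∀ w → All (_< height w) (values w)
values<height end          = []
values<height (single w)   = n<1+n _ ∷ All.map m<n⇒m<1+n (values<height w)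
values<height (skip w)     = All.map m<n⇒m<1+n (values<height w)
values<height (double w _) = m<n⇒m<1+n (n<1+n _) ∷ m<n⇒m<1+n (n<1+n _) ∷
  All.map (m<n⇒m<1+n ∘ m<n⇒m<1+n) (values<height w)

gapped-values : ∀ w → Gapped w → All (λ x → suc x < height w) (values w)
gapped-values (skip w)     _ = All.map s<s (values<height w)
gapped-values (double w _) _ = n<1+n _ ∷ n<1+n _ ∷ All.map (s<s ∘ m<n⇒m<1+n) (values<height w)

-- Each position of the word either keeps its bit or is one of the two positions deleted with a
-- double part.
height-bits : ∀ w → height w ≡ suc (length (bits w) + 2 * length (exps w))
height-bits end          = refl
height-bits (single w)   = cong suc (height-bits w)
height-bits (skip w)     = cong suc (height-bits w)
height-bits (double w _) = trans (cong (2 +_) (height-bits w)) (lemma (length (bits w)) (length (exps w)))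
  where
  lemma : ∀ b e → 2 + suc (b + 2 * e) ≡ suc (b + 2 * suc e)
  lemma = solve-∀

-- Relating f to the words

nth-doubles<height : ∀ w k → nth (doubles w) k < height w
-- Past the last double part `nth` returns 0, the convention for R at D + 1.
nth-doubles<height end          k       = z<s
nth-doubles<height (single w)   k       = m<n⇒m<1+n (nth-doubles<height w k)
nth-doubles<height (skip w)     k       = m<n⇒m<1+n (nth-doubles<height w k)
nth-doubles<height (double w _) zero    = m<n⇒m<1+n (n<1+n _)
nth-doubles<height (double w _) (suc k) = m<n⇒m<1+n (m<n⇒m<1+n (nth-doubles<height w k))

length-exps : ∀ w → length (doubles w) ≡ length (exps w)
length-exps end          = refl
length-exps (single w)   = length-exps w
length-exps (skip w)     = length-exps w
length-exps (double w _) = cong suc (length-exps w)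

-- The positions above the topmost double part, up to and including `height w`, are single parts,
-- absent values and `height w` itself. The last one is the extra unit in `gaps`: 1 at `end`, 2
-- right above a double part.
gaps-spec : ∀ w → height w ≡ gaps w + length (blocks w 0) + nth (doubles w) 0
gaps-spec end          = refl
gaps-spec (single w)   = trans (cong suc (gaps-spec w))
  (cong (_+ nth (doubles w) 0) (sym (+-suc (gaps w) (length (blocks w 0)))))
gaps-spec (skip w)     = cong suc (gaps-spec w)
gaps-spec (double w _) = refl

gaps-∸ : ∀ w → height w ∸ nth (doubles w) 0 ∸ length (blocks w 0) ≡ gaps w
gaps-∸ w = begin
  height w ∸ n ∸ l       ≡⟨ cong (λ h → h ∸ n ∸ l) (gaps-spec w) ⟩
  gaps w + l + n ∸ n ∸ l ≡⟨ cong (_∸ l) (m+n∸n≡m (gaps w + l) n) ⟩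
  gaps w + l ∸ l         ≡⟨ m+n∸n≡m (gaps w) l ⟩
  gaps w                 ∎
  where
  open ≡-Reasoning
  n = nth (doubles w) 0
  l = length (blocks w 0)

applyUpTo-cong : {A : Set} {g h : ℕ → A} → (∀ i → g i ≡ h i) → ∀ n → applyUpTo g n ≡ applyUpTo h n
applyUpTo-cong eq zero    = refl
applyUpTo-cong eq (suc n) = cong₂ _∷_ (eq 0) (applyUpTo-cong (eq ∘ suc) n)

exponent : Word → ℕ → ℕ
exponent w k = nth (doubles w) k ∸ nth (doubles w) (suc k) ∸ length (blocks w (suc k))

-- The offset `c` counts the double parts already passed above `w`.
concat-evens : ∀ c w → concat (applyUpTo (λ k → replicate (exponent w k) (2 * suc (c + k))) (length (exps w)))
                     ≡ evens c (exps w)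
concat-evens c end          = refl
concat-evens c (single w)   = concat-evens c w
concat-evens c (skip w)     = concat-evens c w
concat-evens c (double w _) = cong₂ _++_
  (cong₂ (λ n k → replicate n (2 * suc k)) (gaps-∸ w) (+-identityʳ c))
  (trans
    (cong concat (applyUpTo-cong
      (λ k → cong (λ i → replicate (exponent w k) (2 * suc i)) (+-suc c k)) (length (exps w))))
    (concat-evens (suc c) w))

concat-singles : ∀ c w →
  concat (applyUpTo (λ i → map (_+ 2 * (c + i)) (blocks w i)) (suc (length (exps w))))
  ≡ singles (2 * (c + length (exps w))) (bits w)
concat-singles c end          = refl
concat-singles c (single w)   = cong₂ _∷_
  -- With b bits and e double parts below it and c double parts above, a single part
  -- `suc (b + 2 * e)` is raised by 2c, so only the total c + e matters.
  (trans (cong (_+ 2 * (c + 0)) (height-bits w)) (lemma c (length (bits w)) (length (exps w))))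
  (concat-singles c w)
  where
  lemma : ∀ c b e → suc (b + 2 * e) + 2 * (c + 0) ≡ suc (b + 2 * (c + e))
  lemma = solve-∀
concat-singles c (skip w)     = concat-singles c w
concat-singles c (double w _) = trans
  (cong concat (applyUpTo-cong
    (λ i → cong (λ j → map (_+ 2 * j) (blocks w i)) (+-suc c i)) (suc (length (exps w)))))
  (trans (concat-singles (suc c) w)
    (cong (λ j → singles (2 * j) (bits w)) (sym (+-suc c (length (exps w))))))

filter-cong : {P Q : Pred ℕ 0ℓ} (P? : Decidable P) (Q? : Decidable Q) {xs : List ℕ} →
              All (λ x → (P x → Q x) × (Q x → P x)) xs → filter P? xs ≡ filter Q? xs
filter-cong P? Q? {[]}     []              = refl
filter-cong P? Q? {x ∷ xs} ((pq , qp) ∷ eqs) with P? x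
... | yes px = trans (cong (x ∷_) (filter-cong P? Q? eqs)) (sym (filter-accept Q? (pq px)))
... | no ¬px = trans (filter-cong P? Q? eqs) (sym (filter-reject Q? (¬px ∘ qp)))

-- `BelowR` depends on the partition only through its double parts. Abstracting them to a list
-- allows `doubleParts π` to be rewritten to `doubles w` inside the decision procedure.
Below : List ℕ → ℕ → Pred ℕ 0ℓ
Below ds zero    x = ⊤
Below ds (suc i) x = x < nth ds i

below? : ∀ ds i → Decidable (Below ds i)
below? ds zero    x = yes tt
below? ds (suc i) x = x <? nth ds i

Between : List ℕ → ℕ → Pred ℕ 0ℓ
Between ds k x = nth ds k < x × Below ds k x

between? : ∀ ds k → Decidable (Between ds k)
between? ds k = (nth ds k <?_) ∩? below? ds k

parts-block : ∀ π k → parts (block π k) ≡ filter (between? (doubleParts π) k) (parts π)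
parts-block π zero    = refl
parts-block π (suc k) = refl

filter-between : ∀ w k → filter (between? (doubles w) k) (values w) ≡ blocks w k
filter-between end          k       = refl
filter-between (single w)   zero    = trans
  (filter-accept (between? (doubles w) 0) (nth-doubles<height w 0 , tt))
  (cong (height w ∷_) (filter-between w 0))
filter-between (single w)   (suc k) = trans
  (filter-reject (between? (doubles w) (suc k)) (λ (_ , h<) → <-asym h< (nth-doubles<height w k)))
  (filter-between w (suc k))
filter-between (skip w)     k       = filter-between w k
filter-between (double w _) zero    = filter-none (between? (height w ∷ doubles w) 0)
  (<-irrefl refl ∘ proj₁ ∷ <-irrefl refl ∘ proj₁ ∷
    All.map (λ x< → <-asym x< ∘ proj₁) (values<height w))
filter-between (double w g) (suc k) =
  trans (filter-reject P? (high k)) (trans (filter-reject P? (high k)) (inner k))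
  where
  P? = λ {k} → between? (height w ∷ doubles w) (suc k)
  high : ∀ k → ¬ Between (height w ∷ doubles w) (suc k) (height w)
  high zero    (_ , h<) = <-irrefl refl h<
  high (suc k) (_ , h<) = <-asym h< (nth-doubles<height w k)
  inner : ∀ k → filter (P? {k}) (values w) ≡ blocks w k
  -- The block right under the top double part is bounded above in the longer list and unbounded in
  -- the shorter one; on the values of `w` the bound holds automatically.
  inner zero    = trans
    (filter-cong (P? {0}) (between? (doubles w) 0)
      (All.map (λ x< → (λ (p , _) → p , tt) , (λ (p , _) → p , x<)) (values<height w)))
    (filter-between w 0)
  inner (suc k) = filter-between w (suc k)

deduplicated : Word → List ℕ
deduplicated end          = []
deduplicated (single w)   = height w ∷ deduplicated w
deduplicated (skip w)     = deduplicated w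
deduplicated (double w _) = height w ∷ deduplicated w

deduplicated<height : ∀ w → All (_< height w) (deduplicated w)
deduplicated<height end          = []
deduplicated<height (single w)   = n<1+n _ ∷ All.map m<n⇒m<1+n (deduplicated<height w)
deduplicated<height (skip w)     = All.map m<n⇒m<1+n (deduplicated<height w)
deduplicated<height (double w _) = m<n⇒m<1+n (n<1+n _) ∷
  All.map (m<n⇒m<1+n ∘ m<n⇒m<1+n) (deduplicated<height w)

filter-≢-height : ∀ w → filter (¬? ∘ (height w ≟_)) (deduplicated w) ≡ deduplicated w
filter-≢-height w = filter-all (¬? ∘ (height w ≟_)) (All.map (≢-sym ∘ <⇒≢) (deduplicated<height w))

deduplicate-values : ∀ w → deduplicate _≟_ (values w) ≡ deduplicated w
deduplicate-values end          = refl
deduplicate-values (single w)   = cong (height w ∷_)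
  (trans (cong (filter (¬? ∘ (height w ≟_))) (deduplicate-values w)) (filter-≢-height w))
deduplicate-values (skip w)     = deduplicate-values w
deduplicate-values (double w _) = cong (height w ∷_) (begin
  filter P? (height w ∷ filter P? (deduplicate _≟_ (values w)))
    ≡⟨ cong (λ xs → filter P? (height w ∷ filter P? xs)) (deduplicate-values w) ⟩
  filter P? (height w ∷ filter P? (deduplicated w))
    ≡⟨ cong (λ xs → filter P? (height w ∷ xs)) (filter-≢-height w) ⟩
  filter P? (height w ∷ deduplicated w)
    ≡⟨ filter-reject P? (λ h≢h → h≢h refl) ⟩
  filter P? (deduplicated w)
    ≡⟨ filter-≢-height w ⟩
  deduplicated w ∎)
  where
  open ≡-Reasoning
  P? = ¬? ∘ (height w ≟_)

count-height : ∀ w → count (height w) (values w) ≡ 0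
count-height w = count-absent (All.map <⇒≢ (values<height w))

filter-doubles : ∀ w → filter (λ j → count j (values w) ≟ 2) (deduplicated w) ≡ doubles w
filter-doubles end          = refl
filter-doubles (single w)   = begin
  filter P? (height w ∷ deduplicated w) ≡⟨ filter-reject P? notDouble ⟩
  filter P? (deduplicated w)            ≡⟨ filter-cong P? (λ j → count j (values w) ≟ 2) below ⟩
  filter _ (deduplicated w)             ≡⟨ filter-doubles w ⟩
  doubles w                             ∎
  where
  open ≡-Reasoning
  P? = λ j → count j (values (single w)) ≟ 2
  notDouble : count (height w) (values (single w)) ≢ 2
  notDouble eq = contradiction
    (trans (sym (trans (count-≡ (height w) (values w)) (cong suc (count-height w)))) eq) λ ()
  below : All _ (deduplicated w)
  below = All.map
    (λ x< → let eq = count-≢ (≢-sym (<⇒≢ x<)) (values w) in trans (sym eq) , trans eq)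
    (deduplicated<height w)
filter-doubles (skip w)     = filter-doubles w
filter-doubles (double w g) = begin
  filter P? (height w ∷ deduplicated w) ≡⟨ filter-accept P? isDouble ⟩
  height w ∷ filter P? (deduplicated w)
    ≡⟨ cong (height w ∷_) (filter-cong P? (λ j → count j (values w) ≟ 2) below) ⟩
  height w ∷ filter _ (deduplicated w)  ≡⟨ cong (height w ∷_) (filter-doubles w) ⟩
  height w ∷ doubles w                  ∎
  where
  open ≡-Reasoning
  P? = λ j → count j (values (double w g)) ≟ 2
  isDouble : count (height w) (values (double w g)) ≡ 2
  isDouble = trans (count-≡ (height w) (height w ∷ values w))
    (cong suc (trans (count-≡ (height w) (values w)) (cong suc (count-height w))))
  below : All _ (deduplicated w)
  below = All.map
    (λ x< → let h≢ = ≢-sym (<⇒≢ x<)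
                eq = trans (count-≢ h≢ (height w ∷ values w)) (count-≢ h≢ (values w))
            in trans (sym eq) , trans eq)
    (deduplicated<height w)

parts-∪ : ∀ π μ → parts (π ∪ μ) ↭ parts π ++ parts μ
parts-∪ π μ = sort-↭ (parts π ++ parts μ)

parts-⋃ : ∀ n μ → parts (⋃ n μ) ↭ concat (applyUpTo (parts ∘ μ) n)
parts-⋃ n μ = go n id
  where
  go : ∀ n h → parts (foldr _∪_ ∅ (map μ (applyUpTo h n))) ↭ concat (applyUpTo (parts ∘ μ ∘ h) n)
  go zero    h = ↭-refl
  go (suc n) h = ↭-trans
    (parts-∪ (μ (h 0)) (foldr _∪_ ∅ (map μ (applyUpTo (h ∘ suc) n))))
    (++⁺ˡ (parts (μ (h 0))) (go n (h ∘ suc)))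

module _ (π : Partition) (w : Word) (π≡ : parts π ≡ values w) where

  doubleParts-values : doubleParts π ≡ doubles w
  doubleParts-values = begin
    filter (λ j → count j (parts π) ≟ 2) (deduplicate _≟_ (parts π))
      ≡⟨ cong (λ xs → filter (λ j → count j xs ≟ 2) (deduplicate _≟_ xs)) π≡ ⟩
    filter (λ j → count j (values w) ≟ 2) (deduplicate _≟_ (values w))
      ≡⟨ cong (filter (λ j → count j (values w) ≟ 2)) (deduplicate-values w) ⟩
    filter (λ j → count j (values w) ≟ 2) (deduplicated w)
      ≡⟨ filter-doubles w ⟩
    doubles w ∎
    where open ≡-Reasoning

  block-values : ∀ k → parts (block π k) ≡ blocks w k
  block-values k = trans (parts-block π k)
    (trans (cong₂ (λ ds → filter (between? ds k)) doubleParts-values π≡) (filter-between w k))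

  f-image : parts (f π) ↭ image w
  f-image = ↭-trans (parts-∪ (⋃ (D π) columns) (⋃ (suc (D π)) shifted)) (++⁺
    (↭-trans (parts-⋃ (D π) columns) (↭-reflexive (begin
      concat (applyUpTo (parts ∘ columns) (D π))
        ≡⟨ cong (concat ∘ applyUpTo (parts ∘ columns)) D≡ ⟩
      concat (applyUpTo (parts ∘ columns) (length (exps w)))
        ≡⟨ cong concat (applyUpTo-cong (λ k → cong (λ n → replicate n (2 * suc k)) (exponents k))
                                       (length (exps w))) ⟩
      concat (applyUpTo (λ k → replicate (exponent w k) (2 * suc k)) (length (exps w)))
        ≡⟨ concat-evens 0 w ⟩
      evens 0 (exps w) ∎)))
    (↭-trans (parts-⋃ (suc (D π)) shifted) (↭-reflexive (begin
      concat (applyUpTo (parts ∘ shifted) (suc (D π)))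
        ≡⟨ cong (concat ∘ applyUpTo (parts ∘ shifted) ∘ suc) D≡ ⟩
      concat (applyUpTo (parts ∘ shifted) (suc (length (exps w))))
        ≡⟨ cong concat (applyUpTo-cong (λ i → cong (map (_+ 2 * i)) (block-values i)) (suc (length (exps w)))) ⟩
      concat (applyUpTo (λ i → map (_+ 2 * i) (blocks w i)) (suc (length (exps w))))
        ≡⟨ concat-singles 0 w ⟩
      singles (2 * length (exps w)) (bits w) ∎))))
    where
    open ≡-Reasoning
    columns shifted : ℕ → Partition
    columns k = ⟨ 2 * suc k ^ R π (suc k) ∸ R π (suc (suc k)) ∸ ℓ (block π (suc k)) ⟩
    shifted i = block π i +⟨ 2 * i ⟩
    D≡ : D π ≡ length (exps w)
    D≡ = trans (cong length doubleParts-values) (length-exps w)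
    exponents : ∀ k → R π (suc k) ∸ R π (suc (suc k)) ∸ ℓ (block π (suc k)) ≡ exponent w k
    exponents k = cong₂ (λ ds xs → nth ds k ∸ nth ds (suc k) ∸ length xs)
      doubleParts-values (block-values (suc k))

-- Preservation of the size

-- The total of all exponents and all block lengths; with gaps it telescopes to
-- the height.
weight : Word → ℕ
weight end          = 0
weight (single w)   = suc (weight w)
weight (skip w)     = weight w
weight (double w _) = gaps w + weight w

gaps+weight : ∀ w → gaps w + weight w ≡ height w
gaps+weight end          = refl
gaps+weight (single w)   = trans (+-suc (gaps w) (weight w)) (cong suc (gaps+weight w))
gaps+weight (skip w)     = cong suc (gaps+weight w)
gaps+weight (double w _) = cong (2 +_) (gaps+weight w)

sum-replicate : ∀ n x → sum (replicate n x) ≡ n * x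
sum-replicate zero    x = refl
sum-replicate (suc n) x = cong (x +_) (sum-replicate n x)

-- With c double parts above it, `w` contributes `weight w` parts to the image, each raised by a
-- further 2c. Passing a double part raises c by one, which adds twice `gaps w + weight w`, that is,
-- twice the height: the two copies of the double part.
sum-shifted : ∀ c w →
  sum (evens c (exps w)) + sum (singles (2 * (c + length (exps w))) (bits w))
  ≡ sum (values w) + 2 * c * weight w
sum-shifted c end          = sym (*-zeroʳ (2 * c))
sum-shifted c (single w)   = begin
  E + (suc (b + 2 * (c + e)) + S)                   ≡⟨ regroup b c e E S ⟩
  suc (b + 2 * e) + 2 * c + (E + S)                 ≡⟨ cong (suc (b + 2 * e) + 2 * c +_) (sum-shifted c w) ⟩
  suc (b + 2 * e) + 2 * c + (V + 2 * c * weight w)  ≡⟨ cong (λ h → h + 2 * c + (V + 2 * c * weight w)) (height-bits w) ⟨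
  height w + 2 * c + (V + 2 * c * weight w)         ≡⟨ collect (height w) c V (weight w) ⟩
  height w + V + 2 * c * suc (weight w)             ∎
  where
  open ≡-Reasoning
  b = length (bits w)
  e = length (exps w)
  E = sum (evens c (exps w))
  S = sum (singles (2 * (c + e)) (bits w))
  V = sum (values w)
  regroup : ∀ b c e E S → E + (suc (b + 2 * (c + e)) + S) ≡ suc (b + 2 * e) + 2 * c + (E + S)
  regroup = solve-∀
  collect : ∀ h c V t → h + 2 * c + (V + 2 * c * t) ≡ h + V + 2 * c * suc t
  collect = solve-∀
sum-shifted c (skip w)     = sum-shifted c w
sum-shifted c (double w _) = begin
  sum (replicate g (2 * suc c) ++ evens (suc c) (exps w)) + sum (singles (2 * (c + suc e)) (bits w))
    ≡⟨ cong₂ _+_ (trans (sum-++ (replicate g (2 * suc c)) (evens (suc c) (exps w)))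
                        (cong (_+ sum (evens (suc c) (exps w))) (sum-replicate g (2 * suc c))))
                 (cong (λ k → sum (singles (2 * k) (bits w))) (+-suc c e)) ⟩
  g * (2 * suc c) + sum (evens (suc c) (exps w)) + sum (singles (2 * (suc c + e)) (bits w))
    ≡⟨ +-assoc (g * (2 * suc c)) _ _ ⟩
  g * (2 * suc c) + (sum (evens (suc c) (exps w)) + sum (singles (2 * (suc c + e)) (bits w)))
    ≡⟨ cong (g * (2 * suc c) +_) (sum-shifted (suc c) w) ⟩
  g * (2 * suc c) + (V + 2 * suc c * t)
    ≡⟨ collect g c V t ⟩
  (g + t) + ((g + t) + V) + 2 * c * (g + t)
    ≡⟨ cong (λ h → h + (h + V) + 2 * c * (g + t)) (gaps+weight w) ⟩
  height w + (height w + V) + 2 * c * (g + t) ∎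
  where
  open ≡-Reasoning
  g = gaps w
  t = weight w
  e = length (exps w)
  V = sum (values w)
  collect : ∀ g c V t → g * (2 * suc c) + (V + 2 * suc c * t) ≡ (g + t) + ((g + t) + V) + 2 * c * (g + t)
  collect = solve-∀

sum-image : ∀ w → sum (image w) ≡ sum (values w)
sum-image w = begin
  sum (image w)                                                 ≡⟨ sum-++ (evens 0 (exps w)) _ ⟩
  sum (evens 0 (exps w)) + sum (singles (2 * length (exps w)) (bits w)) ≡⟨ sum-shifted 0 w ⟩
  sum (values w) + 0                                            ≡⟨ +-identityʳ _ ⟩
  sum (values w)                                                ∎
  where open ≡-Reasoning

-- Reading off the word

skips : ℕ → Word → Word
skips zero    w = w
skips (suc k) w = skip (skips k w)

values-skips : ∀ k w → values (skips k w) ≡ values w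
values-skips zero    w = refl
values-skips (suc k) w = values-skips k w

exps-skips : ∀ k w → exps (skips k w) ≡ exps w
exps-skips zero    w = refl
exps-skips (suc k) w = exps-skips k w

height-skips : ∀ k w → height (skips k w) ≡ k + height w
height-skips zero    w = refl
height-skips (suc k) w = cong suc (height-skips k w)

-- Without absent values on top, the outermost constructor holds the largest part, against which the
-- next part can be compared.
Reduced : Word → Set
Reduced (skip _) = ⊥
Reduced _        = ⊤

NonAdjacent : List ℕ → Set
NonAdjacent xs = ∀ j → 1 ≤ j → count j xs + count (suc j) xs ≤ 2

nonAdjacent-tail : ∀ {x xs} → NonAdjacent (x ∷ xs) → NonAdjacent xs
nonAdjacent-tail {x} {xs} na j 1≤j =
  ≤-trans (+-mono-≤ (count-∷-≤ j x xs) (count-∷-≤ (suc j) x xs)) (na j 1≤j)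

push : ∀ w x → height w ≤ x → Σ[ w′ ∈ Word ] values w′ ≡ x ∷ values w × Reduced w′
push w x h≤x = single (skips (x ∸ height w) w) ,
  cong₂ _∷_ (trans (height-skips (x ∸ height w) w) (m∸n+n≡m h≤x)) (values-skips (x ∸ height w) w) , tt

count≥1 : ∀ j xs → 1 ≤ count j (j ∷ xs)
count≥1 j xs = ≤-trans (s≤s z≤n) (≤-reflexive (sym (count-≡ j xs)))

count≥2 : ∀ j xs → 2 ≤ count j (j ∷ j ∷ xs)
count≥2 j xs = ≤-trans (s≤s (count≥1 j xs)) (≤-reflexive (sym (count-≡ j (j ∷ xs))))

word : ∀ xs → Linked _≥_ xs → All (0 <_) xs → count 1 xs ≤ 1 → NonAdjacent xs →
       Σ[ w ∈ Word ] values w ≡ xs × Reduced w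
word []       _   _          _  _  = end , refl , tt
word (x ∷ xs) x≥ (0<x ∷ 0<) c₁ na
  with word xs (Linked.tail x≥) 0< (≤-trans (count-∷-≤ 1 x xs) c₁) (nonAdjacent-tail {x} {xs} na)
... | end        , refl , _ = push end x 0<x
... | single w   , refl , _ with height w ≟ x
...   | no  h≢x = push (single w) x (≤∧≢⇒< (Linked.head x≥) h≢x)
-- A second copy turns the single part into a double one. A part directly below, or position 1,
-- would violate the multiplicity conditions.
...   | yes refl = double w (gapped w c₁ na) , refl , tt
  where
  gapped : ∀ w → count 1 (height w ∷ height w ∷ values w) ≤ 1 →
           NonAdjacent (height w ∷ height w ∷ values w) → Gapped w
  gapped end          c₁ na = contradiction c₁ (<⇒≱ (count≥2 1 []))
  gapped (single w)   c₁ na = contradiction (na h (0<height w)) (<⇒≱ (+-mono-≤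
      (≤-trans (count≥1 h (values w))
        (≤-trans (count-∷-≤ h (suc h) _) (count-∷-≤ h (suc h) _)))
      (count≥2 (suc h) (h ∷ values w))))
    where h = height w
  gapped (skip w)     c₁ na = tt
  gapped (double w _) c₁ na = tt
word (x ∷ xs) x≥ (0<x ∷ 0<) c₁ na | double w g , refl , _ with height w ≟ x | suc (height w) ≟ x
... | no h≢x | no 1+h≢x = push (double w g) x (≤∧≢⇒< (≤∧≢⇒< (Linked.head x≥) h≢x) 1+h≢x)
-- A third copy of a double part, or the value right above it, would give two neighbouring
-- multiplicities with sum at least 3.
... | yes refl | _ = contradiction (na x 0<x) (<⇒≱ (≤-trans
  (≤-trans (s≤s (count≥2 x (values w))) (≤-reflexive (sym (count-≡ x (x ∷ x ∷ values w)))))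
  (m≤m+n _ _)))
... | no _ | yes refl = contradiction (na (height w) (0<height w)) (<⇒≱ (+-mono-≤
  (≤-trans (count≥2 (height w) (values w)) (count-∷-≤ (height w) x _))
  (count≥1 x (height w ∷ height w ∷ values w))))

toWord : ∀ π → π ∈ G₂ → Σ[ w ∈ Word ] parts π ≡ values w
toWord π (m₁ , na) with w , eq , _ ← word (parts π) (nonincreasing π) (positive π) m₁ na = w , sym eq

size-f : ∀ π → π ∈ G₂ → ∣ f π ∣ ≡ ∣ π ∣
size-f π π∈ = let w , eq = toWord π π∈ in
  trans (sum-↭ (f-image π w eq)) (trans (sum-image w) (cong sum (sym eq)))

-- The image lies in 𝒜₁

evens-range : ∀ c es → All (λ x → 2 ∣ x × 2 * c < x × x ≤ 2 * (c + length es)) (evens c es)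
evens-range c []       = []
evens-range c (e ∷ es) = All.++⁺
  (All.replicate⁺ e (m∣m*n (suc c) , *-monoʳ-< 2 (n<1+n c) ,
    *-monoʳ-≤ 2 (≤-trans (m≤m+n (suc c) (length es)) (≤-reflexive (sym (+-suc c (length es)))))))
  (All.map
    (λ (even , lower , upper) → even , <-trans (*-monoʳ-< 2 (n<1+n c)) lower ,
      ≤-trans upper (≤-reflexive (cong (2 *_) (sym (+-suc c (length es))))))
    (evens-range (suc c) es))

count-evens : ∀ c es k → count (2 * suc (c + k)) (evens c es) ≡ nth es k
count-evens c []       k       = refl
count-evens c (e ∷ es) zero    = begin
  count j (replicate e (2 * suc c) ++ evens (suc c) es)         ≡⟨ count-++ j (replicate e _) _ ⟩
  count j (replicate e (2 * suc c)) + count j (evens (suc c) es)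
    ≡⟨ cong₂ _+_ (trans (cong (λ i → count j (replicate e (2 * suc i))) (sym (+-identityʳ c)))
                        (count-replicate j e))
                 (count-absent (All.map (λ (_ , lower , _) → ≢-sym (<⇒≢
                   (subst (λ i → 2 * suc i < _) (sym (+-identityʳ c)) lower))) (evens-range (suc c) es))) ⟩
  e + 0                                                         ≡⟨ +-identityʳ e ⟩
  e                                                             ∎
  where
  open ≡-Reasoning
  j = 2 * suc (c + 0)
count-evens c (e ∷ es) (suc k) = begin
  count j (replicate e (2 * suc c) ++ evens (suc c) es)         ≡⟨ count-++ j (replicate e _) _ ⟩
  count j (replicate e (2 * suc c)) + count j (evens (suc c) es)
    ≡⟨ cong (_+ count j (evens (suc c) es))
            (count-absent (All.replicate⁺ e (<⇒≢ (*-monoʳ-< 2 (s<s (m<m+n c z<s)))))) ⟩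
  count j (evens (suc c) es)
    ≡⟨ cong (λ i → count (2 * suc i) (evens (suc c) es)) (+-suc c k) ⟩
  count (2 * suc (suc c + k)) (evens (suc c) es)                ≡⟨ count-evens (suc c) es k ⟩
  nth es k                                                      ∎
  where
  open ≡-Reasoning
  j = 2 * suc (c + suc k)

singles-range : ∀ c bs → All (λ x → c < x × x ≤ length bs + c) (singles c bs)
singles-range c []           = []
singles-range c (true ∷ bs)  = (s≤s (m≤n+m c (length bs)) , ≤-refl) ∷
  All.map (λ (lower , upper) → lower , m≤n⇒m≤1+n upper) (singles-range c bs)
singles-range c (false ∷ bs) = All.map (λ (lower , upper) → lower , m≤n⇒m≤1+n upper) (singles-range c bs)

count-singles-≤1 : ∀ c bs j → count j (singles c bs) ≤ 1
count-singles-≤1 c []           j = z≤n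
count-singles-≤1 c (false ∷ bs) j = count-singles-≤1 c bs j
count-singles-≤1 c (true ∷ bs)  j with suc (length bs + c) ≟ j
... | no x≢j   = ≤-trans (≤-reflexive (count-≢ x≢j (singles c bs))) (count-singles-≤1 c bs j)
... | yes refl = ≤-reflexive (trans (count-≡ j (singles c bs))
  (cong suc (count-absent (All.map (λ (_ , upper) → <⇒≢ (s≤s upper)) (singles-range c bs)))))

gapped⇒1<height : ∀ w → Gapped w → 1 < height w
gapped⇒1<height (skip w)     _ = s<s (0<height w)
gapped⇒1<height (double w _) _ = s<s z<s

-- Below a chain of touching double parts lies a plain absent value, whose bit survives. So the
-- deletion never lets a position above 1 drop to the bottom.
0<length-bits : ∀ w → 1 < height w → 0 < length (bits w)
0<length-bits end          (s≤s ())
0<length-bits (single w)   _ = z<s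
0<length-bits (skip w)     _ = z<s
0<length-bits (double w g) _ = 0<length-bits w (gapped⇒1<height w g)

-- A part larger than 1 keeps some bit below it and so misses the lowest value `suc c`.
singles-above : ∀ c w → All (1 <_) (values w) → All (suc c <_) (singles c (bits w))
singles-above c end          _          = []
singles-above c (single w)   (1<h ∷ 1<) = s<s (m<n+m c (0<length-bits w 1<h)) ∷ singles-above c w 1<
singles-above c (skip w)     1<         = singles-above c w 1<
singles-above c (double w _) (_ ∷ _ ∷ 1<) = singles-above c w 1<

0<gaps : ∀ w → 0 < gaps w
0<gaps end          = z<s
0<gaps (single w)   = 0<gaps w
0<gaps (skip w)     = z<s
0<gaps (double w _) = z<s

gapped⇒2≤gaps : ∀ w → Gapped w → 2 ≤ gaps w
gapped⇒2≤gaps (skip w)     _ = s≤s (0<gaps w)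
gapped⇒2≤gaps (double w _) _ = ≤-refl

-- The absent value directly below a double part counts in addition to the constant unit in `gaps`.
2≤exps : ∀ w → All (2 ≤_) (exps w)
2≤exps end          = []
2≤exps (single w)   = 2≤exps w
2≤exps (skip w)     = 2≤exps w
2≤exps (double w g) = gapped⇒2≤gaps w g ∷ 2≤exps w

All-nth : {P : Pred ℕ 0ℓ} {xs : List ℕ} → All P xs → ∀ {k} → k < length xs → P (nth xs k)
All-nth (p ∷ ps) {zero}  _         = p
All-nth (p ∷ ps) {suc k} (s≤s k<n) = All-nth ps k<n

max-≤ : ∀ {n xs} → All (_≤ n) xs → foldr _⊔_ 0 xs ≤ n
max-≤ []       = z≤n
max-≤ (p ∷ ps) = ⊔-lub p (max-≤ ps)

largestRepeated-≤ : ∀ π {n} → (∀ j → 2 ≤ m j π → j ≤ n) → largestRepeated π ≤ n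
largestRepeated-≤ π bound =
  max-≤ (All.map (bound _) (All.all-filter (λ j → 2 ≤? m j π) (parts π)))

evens-large : ∀ es {j} → 2 * length es < j → count j (evens 0 es) ≡ 0
evens-large es 2d<j = count-absent (All.map (λ (_ , _ , upper) → <⇒≢ (≤-<-trans upper 2d<j)) (evens-range 0 es))

evens-odd : ∀ es {j} → 2 ∤ j → count j (evens 0 es) ≡ 0
evens-odd es odd = count-absent (All.map (λ (even , _) → λ { refl → odd even }) (evens-range 0 es))

singles-small : ∀ bs {j c} → j ≤ c → count j (singles c bs) ≡ 0
singles-small bs j≤c = count-absent
  (All.map (λ (lower , _) → ≢-sym (<⇒≢ (≤-<-trans j≤c lower))) (singles-range _ bs))

module _ (π : Partition) (es : List ℕ) (bs : List Bool)
         (π↭ : parts π ↭ evens 0 es ++ singles (2 * length es) bs) where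

  private
    d = length es

  m-image : ∀ j → m j π ≡ count j (evens 0 es) + count j (singles (2 * d) bs)
  m-image j = trans (count-↭ j π↭) (count-++ j (evens 0 es) _)

  m-large : ∀ {j} → 2 * d < j → m j π ≡ count j (singles (2 * d) bs)
  m-large {j} 2d<j = trans (m-image j) (cong (_+ count j (singles (2 * d) bs)) (evens-large es 2d<j))

  m-small : ∀ {j} → j ≤ 2 * d → m j π ≡ count j (evens 0 es)
  m-small {j} j≤2d = trans (m-image j)
    (trans (cong (count j (evens 0 es) +_) (singles-small bs j≤2d)) (+-identityʳ _))

  m-even : ∀ {k} → k < d → m (2 * suc k) π ≡ nth es k
  m-even {k} k<d = trans (m-small (*-monoʳ-≤ 2 k<d)) (count-evens 0 es k)

  repeated-≤ : ∀ j → 2 ≤ m j π → j ≤ 2 * d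
  repeated-≤ j 2≤m = ≮⇒≥ λ 2d<j →
    <⇒≱ 2≤m (≤-trans (≤-reflexive (m-large 2d<j)) (count-singles-≤1 (2 * d) bs j))

  image∈A₁ : All (2 ≤_) es → All (suc (2 * d) <_) (singles (2 * d) bs) → π ∈ A₁
  image∈A₁ 2≤es above = odd-≤1 , odd-absent , even-repeated
    where
    odd-≤1 : ∀ j → 2 ∤ j → m j π ≤ 1
    odd-≤1 j odd = ≤-trans
      (≤-reflexive (trans (m-image j) (cong (_+ count j (singles (2 * d) bs)) (evens-odd es odd))))
      (count-singles-≤1 (2 * d) bs j)

    odd-absent : ∀ j → 2 ∤ j → j < largestRepeated π + 2 → m j π ≡ 0
    odd-absent j odd j< = trans (m-image j) (cong₂ _+_ (evens-odd es odd)
      (count-absent (All.map (λ x> → ≢-sym (<⇒≢ (≤-<-trans j≤ x>))) above)))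
      where
      -- From j < R₁ + 2 ≤ 2d + 2; the single parts start beyond 2d + 1.
      j≤ : j ≤ suc (2 * d)
      j≤ = s≤s⁻¹ (≤-trans j< (≤-trans
        (+-monoˡ-≤ 2 (largestRepeated-≤ π repeated-≤)) (≤-reflexive (+-comm (2 * d) 2))))

    even-repeated : ∀ j → 2 ∣ j → 0 < j → j < largestRepeated π → 2 ≤ m j π
    even-repeated .(zero * 2)  (divides zero refl)    ()
    even-repeated .(suc k * 2) (divides (suc k) refl) _ j< =
      subst (λ i → 2 ≤ m i π) (*-comm 2 (suc k))
        (≤-trans (All-nth 2≤es k<d) (≤-reflexive (sym (m-even k<d))))
      where
      k<d : k < d
      k<d = *-cancelˡ-≤ 2 (≤-trans (≤-reflexive (*-comm 2 (suc k)))
        (<⇒≤ (<-≤-trans j< (largestRepeated-≤ π repeated-≤))))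

above : ∀ {n} xs → All (n <_) xs → count (suc n) xs ≡ 0 → All (suc n <_) xs
above     []       []         _    = []
above {n} (x ∷ xs) (n<x ∷ n<) none with x ≟ suc n
... | yes refl = contradiction (trans (sym (count-≡ (suc n) xs)) none) λ ()
... | no  x≢   = ≤∧≢⇒< n<x (≢-sym x≢) ∷ above xs n< (trans (sym (count-≢ x≢ xs)) none)

G₁⊆G₂ : ∀ {π} → π ∈ G₁ → π ∈ G₂
G₁⊆G₂ (m₁ , na) = subst (_≤ 1) (sym m₁) z≤n , na

f-maps : ∀ {π} → π ∈ G₁ → f π ∈ A₁
f-maps {π} π∈@(m₁ , _) = let w , eq = toWord π (G₁⊆G₂ {π} π∈) in
  image∈A₁ (f π) (exps w) (bits w) (f-image π w eq) (2≤exps w)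
    (singles-above _ w (subst (All (1 <_)) eq (above (parts π) (positive π) m₁)))

-- Injectivity

singles-head : ∀ c bs bs′ → length bs ≡ length bs′ →
               count (suc (length bs + c)) (singles c (true ∷ bs)) ≢ count (suc (length bs + c)) (singles c bs′)
singles-head c bs bs′ len eq = 0≢1+n (begin
  0
    ≡⟨ count-absent (All.map (λ (_ , upper) → <⇒≢ (s≤s (subst (λ n → _ ≤ n + c) (sym len) upper)))
                             (singles-range c bs′)) ⟨
  count (suc (length bs + c)) (singles c bs′)     ≡⟨ eq ⟨
  count (suc (length bs + c)) (singles c (true ∷ bs)) ≡⟨ count-≡ _ (singles c bs) ⟩
  suc (count (suc (length bs + c)) (singles c bs)) ∎)
  where open ≡-Reasoning

-- For equal lengths the leading bits stand for the same value, larger than everything after it, so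
-- the multiplicity of that value reveals the bit.
singles-injective : ∀ c bs bs′ → length bs ≡ length bs′ →
                    (∀ j → count j (singles c bs) ≡ count j (singles c bs′)) → bs ≡ bs′
singles-injective c []           []            len eq = refl
singles-injective c (true ∷ bs)  (true ∷ bs′)  len eq = cong (true ∷_)
  (singles-injective c bs bs′ (suc-injective len) (count-∷-cancel (suc (length bs + c)) _ _ λ j →
    trans (eq j) (cong (λ n → count j (suc (n + c) ∷ singles c bs′)) (sym (suc-injective len)))))
singles-injective c (false ∷ bs) (false ∷ bs′) len eq = cong (false ∷_)
  (singles-injective c bs bs′ (suc-injective len) eq)
singles-injective c (true ∷ bs)  (false ∷ bs′) len eq =
  contradiction (eq _) (singles-head c bs bs′ (suc-injective len))
singles-injective c (false ∷ bs) (true ∷ bs′)  len eq =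
  contradiction (sym (eq _)) (singles-head c bs′ bs (sym (suc-injective len)))

nth-injective : ∀ xs ys → length xs ≡ length ys → (∀ k → k < length xs → nth xs k ≡ nth ys k) → xs ≡ ys
nth-injective []       []       len eq = refl
nth-injective (x ∷ xs) (y ∷ ys) len eq =
  cong₂ _∷_ (eq 0 z<s) (nth-injective xs ys (suc-injective len) (λ k k< → eq (suc k) (s<s k<)))

ones : List Bool → ℕ
ones []           = 0
ones (true ∷ bs)  = suc (ones bs)
ones (false ∷ bs) = ones bs

weight-bits : ∀ w → weight w ≡ ones (bits w) + sum (exps w)
weight-bits end          = refl
weight-bits (single w)   = cong suc (weight-bits w)
weight-bits (skip w)     = weight-bits w
weight-bits (double w _) = trans (cong (gaps w +_) (weight-bits w)) (lemma (gaps w) (ones (bits w)) (sum (exps w)))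
  where
  lemma : ∀ g o s → g + (o + s) ≡ o + (g + s)
  lemma = solve-∀

height-determined : ∀ w w′ → bits w ≡ bits w′ → exps w ≡ exps w′ → height w ≡ height w′
height-determined w w′ bs es = trans (height-bits w)
  (trans (cong₂ (λ b e → suc (length b + 2 * length e)) bs es) (sym (height-bits w′)))

-- `gaps` is the difference of `height` and `weight`, both computable from bits and exponents.
gaps-determined : ∀ w w′ → bits w ≡ bits w′ → exps w ≡ exps w′ → gaps w ≡ gaps w′
gaps-determined w w′ bs es = +-cancelʳ-≡ (weight w) (gaps w) (gaps w′) (begin
  gaps w + weight w   ≡⟨ gaps+weight w ⟩
  height w            ≡⟨ height-determined w w′ bs es ⟩
  height w′           ≡⟨ gaps+weight w′ ⟨
  gaps w′ + weight w′ ≡⟨ cong (gaps w′ +_) (weight-bits w′) ⟩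
  gaps w′ + (ones (bits w′) + sum (exps w′))
    ≡⟨ cong₂ (λ b e → gaps w′ + (ones b + sum e)) bs es ⟨
  gaps w′ + (ones (bits w) + sum (exps w)) ≡⟨ cong (gaps w′ +_) (weight-bits w) ⟨
  gaps w′ + weight w  ∎)
  where open ≡-Reasoning

-- The first surviving bit under a double part belongs to an absent value. This separates a double
-- part on top from a single one.
gapped-bits : ∀ w → Gapped w → ∀ {bs} → bits w ≢ true ∷ bs
gapped-bits (skip w)     _ ()
gapped-bits (double w g) _ = gapped-bits w g

exps⇒2≤gaps : ∀ w {e es} → exps w ≡ e ∷ es → 2 ≤ gaps w
exps⇒2≤gaps (single w)   eq = exps⇒2≤gaps w eq
exps⇒2≤gaps (skip w)     eq = s≤s (0<gaps w)
exps⇒2≤gaps (double w _) eq = ≤-refl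

-- Above some double part, one more absent value on top makes at least three gaps, while a double
-- part on top leaves exactly two.
skip≁double : ∀ w w′ g → bits (skip w) ≡ bits (double w′ g) → exps (skip w) ≢ exps (double w′ g)
skip≁double w w′ g bs es = <⇒≢ (s≤s (exps⇒2≤gaps w es)) (sym (gaps-determined (skip w) (double w′ g) bs es))

values-determined : ∀ w w′ → bits w ≡ bits w′ → exps w ≡ exps w′ → values w ≡ values w′
values-determined end          end           bs es = refl
values-determined (single w)   (single w′)   bs es =
  let bs′ = ∷-injectiveʳ bs in cong₂ _∷_ (height-determined w w′ bs′ es) (values-determined w w′ bs′ es)
values-determined (skip w)     (skip w′)     bs es = values-determined w w′ (∷-injectiveʳ bs) es
values-determined (double w _) (double w′ _) bs es =
  let es′ = ∷-injectiveʳ es in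
  cong₂ (λ h vs → h ∷ h ∷ vs) (height-determined w w′ bs es′) (values-determined w w′ bs es′)
values-determined (single w)   (double w′ g) bs es = contradiction (sym bs) (gapped-bits w′ g)
values-determined (double w g) (single w′)   bs es = contradiction bs (gapped-bits w g)
values-determined (skip w)     (double w′ g) bs es = contradiction es (skip≁double w w′ g bs)
values-determined (double w g) (skip w′)     bs es = contradiction (sym es) (skip≁double w′ w g (sym bs))
values-determined end          (double _ _)  bs ()
values-determined (double _ _) end           bs ()

singles-skips : ∀ c k w → singles c (bits (skips k w)) ≡ singles c (bits w)
singles-skips c zero    w = refl
singles-skips c (suc k) w = singles-skips c k w

length-bits-skips : ∀ k w → length (bits (skips k w)) ≡ k + length (bits w)
length-bits-skips zero    w = refl
length-bits-skips (suc k) w = cong suc (length-bits-skips k w)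

-- Padding both words with absent values makes their bit lists equally long.
image-determines : ∀ c w w′ → (∀ j → count j (singles c (bits w)) ≡ count j (singles c (bits w′))) →
                   exps w ≡ exps w′ → values w ≡ values w′
image-determines c w w′ counts es = begin
  values w  ≡⟨ values-skips k w ⟨
  values u  ≡⟨ values-determined u u′
                 (singles-injective c (bits u) (bits u′) len λ j →
                   trans (cong (count j) (singles-skips c k w))
                   (trans (counts j) (cong (count j) (sym (singles-skips c k′ w′)))))
                 (trans (exps-skips k w) (trans es (sym (exps-skips k′ w′)))) ⟩
  values u′ ≡⟨ values-skips k′ w′ ⟩
  values w′ ∎
  where
  open ≡-Reasoning
  k = length (bits w′)
  k′ = length (bits w)
  u = skips k w
  u′ = skips k′ w′
  len : length (bits u) ≡ length (bits u′)
  len = trans (length-bits-skips k w) (trans (+-comm k k′) (sym (length-bits-skips k′ w′)))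

-- If the first word has d > 0 double parts, the multiplicity of 2d is its last exponent, at least
-- 2; by the second word nothing beyond twice its own number of double parts is repeated.
length-exps-≤ : ∀ π w w′ → parts π ↭ image w → parts π ↭ image w′ → length (exps w) ≤ length (exps w′)
length-exps-≤ π w w′ p p′ = ≮⇒≥ (go (length (exps w)) refl)
  where
  go : ∀ d → d ≡ length (exps w) → ¬ (length (exps w′) < d)
  go (suc k) eq d′<d = <⇒≱ (*-monoʳ-< 2 d′<d)
    (repeated-≤ π (exps w′) (bits w′) p′ (2 * suc k)
      (≤-trans (All-nth (2≤exps w) k<) (≤-reflexive (sym (m-even π (exps w) (bits w) p k<)))))
    where
    k< : k < length (exps w)
    k< = ≤-reflexive eq

f-injective-words : ∀ π π′ w w′ → parts π ≡ values w → parts π′ ≡ values w′ → f π ≡ f π′ → π ≡ π′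
f-injective-words π π′ w w′ π≡ π′≡ eq =
  partition-≡ (trans π≡ (trans (image-determines (2 * length (exps w)) w w′ counts es≡) (sym π′≡)))
  where
  p : parts (f π) ↭ image w
  p = f-image π w π≡
  p′ : parts (f π) ↭ image w′
  p′ = subst (λ λ′ → parts λ′ ↭ image w′) (sym eq) (f-image π′ w′ π′≡)
  d≡ : length (exps w) ≡ length (exps w′)
  d≡ = ≤-antisym (length-exps-≤ (f π) w w′ p p′) (length-exps-≤ (f π) w′ w p′ p)
  es≡ : exps w ≡ exps w′
  es≡ = nth-injective (exps w) (exps w′) d≡ λ k k< →
    trans (sym (m-even (f π) (exps w) (bits w) p k<))
      (m-even (f π) (exps w′) (bits w′) p′ (subst (k <_) d≡ k<))
  counts : ∀ j → count j (singles (2 * length (exps w)) (bits w))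
               ≡ count j (singles (2 * length (exps w)) (bits w′))
  counts j with j ≤? 2 * length (exps w)
  ... | yes j≤ = trans (singles-small (bits w) j≤) (sym (singles-small (bits w′) j≤))
  ... | no  j≰ = trans (sym (m-large (f π) (exps w) (bits w) p (≰⇒> j≰)))
    (trans (m-large (f π) (exps w′) (bits w′) p′ (subst (λ d → 2 * d < j) d≡ (≰⇒> j≰)))
      (cong (λ d → count j (singles (2 * d) (bits w′))) (sym d≡)))

f-injective : ∀ {π π′} → π ∈ G₁ → π′ ∈ G₁ → f π ≡ f π′ → π ≡ π′
f-injective {π} {π′} π∈ π′∈ =
  let w , π≡ = toWord π (G₁⊆G₂ {π} π∈)
      w′ , π′≡ = toWord π′ (G₁⊆G₂ {π′} π′∈)
  in f-injective-words π π′ w w′ π≡ π′≡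

-- Surjectivity

fromBits : List Bool → Word
fromBits []           = end
fromBits (true ∷ bs)  = single (fromBits bs)
fromBits (false ∷ bs) = skip (fromBits bs)

exps-fromBits : ∀ bs → exps (fromBits bs) ≡ []
exps-fromBits []           = refl
exps-fromBits (true ∷ bs)  = exps-fromBits bs
exps-fromBits (false ∷ bs) = exps-fromBits bs

bits-fromBits : ∀ bs → bits (fromBits bs) ≡ bs
bits-fromBits []           = refl
bits-fromBits (true ∷ bs)  = cong (true ∷_) (bits-fromBits bs)
bits-fromBits (false ∷ bs) = cong (false ∷_) (bits-fromBits bs)

-- A new topmost double part goes right above the lowest absent value that
-- leaves e gaps below it.
insert : ∀ e w → 2 ≤ e → e ≤ gaps w → Σ[ w′ ∈ Word ] exps w′ ≡ e ∷ exps w × bits w′ ≡ bits w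
insert e end          2≤e e≤ = contradiction (≤-trans 2≤e e≤) λ { (s≤s ()) }
insert e (single w)   2≤e e≤ with w′ , es , bs ← insert e w 2≤e e≤ = single w′ , es , cong (true ∷_) bs
insert e (skip w)     2≤e e≤ with e ≟ suc (gaps w)
... | yes refl = double (skip w) tt , refl , refl
... | no  e≢   with w′ , es , bs ← insert e w 2≤e (s≤s⁻¹ (≤∧≢⇒< e≤ e≢)) = skip w′ , es , cong (false ∷_) bs
insert e (double w g) 2≤e e≤ with refl ← ≤-antisym e≤ 2≤e = double (double w g) tt , refl , refl

m≤gaps-skips : ∀ k w → k ≤ gaps (skips k w)
m≤gaps-skips zero    w = z≤n
m≤gaps-skips (suc k) w = s≤s (m≤gaps-skips k w)

-- Exponents are listed from the top, so the tail is realized first and `e` becomes the new topmost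
-- double part. Padding with `e` absent values ensures enough gaps and only adds leading `false`
-- bits, invisible to `singles`.
realize : ∀ {es} → All (2 ≤_) es → ∀ bs →
          Σ[ w ∈ Word ] exps w ≡ es × (∀ c → singles c (bits w) ≡ singles c bs)
realize []                   bs = fromBits bs , exps-fromBits bs , λ c → cong (singles c) (bits-fromBits bs)
realize {e ∷ es} (2≤e ∷ 2≤) bs
  with w , eq , ss ← realize 2≤ bs
  with w′ , es′ , bs′ ← insert e (skips e w) 2≤e (m≤gaps-skips e w) =
  w′ , trans es′ (cong (e ∷_) (trans (exps-skips e w) eq)) ,
  λ c → trans (cong (singles c) bs′) (trans (singles-skips c e w) (ss c))

-- From words to partitions in 𝒢₁

linked-∷ : ∀ {x xs} → All (_≤ x) xs → Linked _≥_ xs → Linked _≥_ (x ∷ xs)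
linked-∷ []      []  = [-]
linked-∷ (p ∷ _) xs≥ = p ∷ xs≥

values-nonincreasing : ∀ w → Linked _≥_ (values w)
values-nonincreasing end          = []
values-nonincreasing (single w)   = linked-∷ (All.map <⇒≤ (values<height w)) (values-nonincreasing w)
values-nonincreasing (skip w)     = values-nonincreasing w
values-nonincreasing (double w _) =
  ≤-refl ∷ linked-∷ (All.map <⇒≤ (values<height w)) (values-nonincreasing w)

values-positive : ∀ w → All (0 <_) (values w)
values-positive end          = []
values-positive (single w)   = 0<height w ∷ values-positive w
values-positive (skip w)     = values-positive w
values-positive (double w _) = 0<height w ∷ 0<height w ∷ values-positive w

fromWord : Word → Partition
fromWord w = mkPartition (values w) (values-nonincreasing w) (values-positive w)

count-≥height : ∀ w {j} → height w ≤ j → count j (values w) ≡ 0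
count-≥height w h≤j = count-absent (All.map (λ x< → <⇒≢ (<-≤-trans x< h≤j)) (values<height w))

-- A double part never occupies the top position, since it carries the absent value above it.
count-below-height : ∀ w {j} → suc j ≡ height w → count j (values w) ≤ 1
count-below-height end          eq   = z≤n
count-below-height (single w)   refl = ≤-reflexive
  (trans (count-≡ (height w) (values w)) (cong suc (count-≥height w ≤-refl)))
count-below-height (skip w)     eq   = ≤-trans
  (≤-reflexive (count-≥height w (≤-reflexive (sym (suc-injective eq))))) z≤n
count-below-height (double w g) refl = ≤-trans
  (≤-reflexive (count-absent (n≢1+n ∷ n≢1+n ∷ All.map (<⇒≢ ∘ m<n⇒m<1+n) (values<height w)))) z≤n
  where
  n≢1+n : ∀ {n} → n ≢ suc n
  n≢1+n ()

values-nonAdjacent : ∀ w → NonAdjacent (values w)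
values-nonAdjacent end          j 1≤j = z≤n
values-nonAdjacent (skip w)     j 1≤j = values-nonAdjacent w j 1≤j
values-nonAdjacent (single w)   j 1≤j with height w ≟ j | height w ≟ suc j
... | yes refl | _ = ≤-trans (≤-reflexive (cong₂ _+_
  (trans (count-≡ (height w) (values w)) (cong suc (count-≥height w ≤-refl)))
  (trans (count-≢ (<⇒≢ (n<1+n _)) (values w)) (count-≥height w (n≤1+n _))))) (s≤s z≤n)
... | no h≢j | yes eq = +-mono-≤
  (≤-trans (≤-reflexive (count-≢ h≢j (values w))) (count-below-height w (sym eq)))
  (≤-reflexive (trans (cong (λ i → count i (height w ∷ values w)) (sym eq))
    (trans (count-≡ (height w) (values w)) (cong suc (count-≥height w ≤-refl)))))
... | no h≢j | no h≢1+j = ≤-trans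
  (≤-reflexive (cong₂ _+_ (count-≢ h≢j (values w)) (count-≢ h≢1+j (values w))))
  (values-nonAdjacent w j 1≤j)
values-nonAdjacent (double w g) j 1≤j with height w ≟ j | height w ≟ suc j
... | yes refl | _ = ≤-reflexive (cong₂ _+_ (twice w)
  (trans (count-≢ (<⇒≢ (n<1+n _)) (height w ∷ values w))
    (trans (count-≢ (<⇒≢ (n<1+n _)) (values w)) (count-≥height w (n≤1+n _)))))
  where
  twice : ∀ w → count (height w) (height w ∷ height w ∷ values w) ≡ 2
  twice w = trans (count-≡ (height w) (height w ∷ values w))
    (cong suc (trans (count-≡ (height w) (values w)) (cong suc (count-≥height w ≤-refl))))
... | no h≢j | yes eq = ≤-reflexive (cong₂ _+_
  (trans (count-≢ h≢j (height w ∷ values w)) (trans (count-≢ h≢j (values w))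
    (count-absent (All.map (λ x< → <⇒≢ (s<s⁻¹ (subst (_ <_) eq x<))) (gapped-values w g)))))
  (trans (cong (λ i → count i (height w ∷ height w ∷ values w)) (sym eq))
    (trans (count-≡ (height w) (height w ∷ values w))
      (cong suc (trans (count-≡ (height w) (values w)) (cong suc (count-≥height w ≤-refl)))))))
... | no h≢j | no h≢1+j = ≤-trans
  (≤-reflexive (cong₂ _+_ (trans (count-≢ h≢j (height w ∷ values w)) (count-≢ h≢j (values w)))
                          (trans (count-≢ h≢1+j (height w ∷ values w)) (count-≢ h≢1+j (values w)))))
  (values-nonAdjacent w j 1≤j)

-- Converse of `singles-above`: a single part 1 would have no bit below it and give `suc c`, and a
-- double part is kept off position 1 by the absent value beneath it.
values-above : ∀ c w → All (suc c <_) (singles c (bits w)) → All (1 <_) (values w)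
values-above c end          _        = []
values-above c (single w)   (p ∷ ps) =
  subst (1 <_) (sym (height-bits w)) (s<s (<-≤-trans (+-cancelʳ-< c 0 _ (s<s⁻¹ p)) (m≤m+n _ _)))
  ∷ values-above c w ps
values-above c (skip w)     ps       = values-above c w ps
values-above c (double w g) ps       = gapped⇒1<height w g ∷ gapped⇒1<height w g ∷ values-above c w ps

fromWord∈G₁ : ∀ w → All (1 <_) (values w) → fromWord w ∈ G₁
fromWord∈G₁ w 1< = count-absent (All.map (≢-sym ∘ <⇒≢) 1<) , values-nonAdjacent w

-- Exponents and bits of a partition in 𝒜₁

≤-max : ∀ {x} xs → x ∈ˡ xs → x ≤ foldr _⊔_ 0 xs
≤-max (x ∷ xs) (here refl) = m≤m⊔n x _
≤-max (y ∷ xs) (there x∈)  = ≤-trans (≤-max xs x∈) (m≤n⊔m y _)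

max-attained : {P : Pred ℕ 0ℓ} {xs : List ℕ} → All P xs → foldr _⊔_ 0 xs ≡ 0 ⊎ P (foldr _⊔_ 0 xs)
max-attained []                       = inj₁ refl
max-attained {P} {x ∷ xs} (px ∷ pxs) with ⊔-sel x (foldr _⊔_ 0 xs) | max-attained pxs
... | inj₁ eq | _       = inj₂ (subst P (sym eq) px)
... | inj₂ eq | inj₁ z  = inj₁ (trans eq z)
... | inj₂ eq | inj₂ p  = inj₂ (subst P (sym eq) p)

≤-largestRepeated : ∀ π {j} → 2 ≤ m j π → j ≤ largestRepeated π
≤-largestRepeated π {j} 2≤m = ≤-max _ (∈-filter⁺ (λ j → 2 ≤? m j π)
  (count-positive⇒∈ j (parts π) (<-≤-trans z<s 2≤m)) 2≤m)

largestRepeated-attained : ∀ π → largestRepeated π ≡ 0 ⊎ 2 ≤ m (largestRepeated π) π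
largestRepeated-attained π = max-attained (All.all-filter (λ j → 2 ≤? m j π) (parts π))

∈⇒≤sum : ∀ {x} xs → x ∈ˡ xs → x ≤ sum xs
∈⇒≤sum (x ∷ xs) (here refl) = m≤m+n x _
∈⇒≤sum (y ∷ xs) (there x∈)  = ≤-trans (∈⇒≤sum xs x∈) (m≤n+m _ y)

m-above-size : ∀ π {j} → ∣ π ∣ < j → m j π ≡ 0
m-above-size π {j} size< = n<1⇒n≡0 (≰⇒> λ 1≤m →
  <⇒≱ size< (∈⇒≤sum (parts π) (count-positive⇒∈ j (parts π) 1≤m)))

nth-applyUpTo : ∀ g {n k} → k < n → nth (applyUpTo g n) k ≡ g k
nth-applyUpTo g {suc n} {zero}  _         = refl
nth-applyUpTo g {suc n} {suc k} (s≤s k<n) = nth-applyUpTo (g ∘ suc) k<n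

singles-large : ∀ bs {j c} → length bs + c < j → count j (singles c bs) ≡ 0
singles-large bs large = count-absent (All.map (λ (_ , upper) → <⇒≢ (≤-<-trans upper large)) (singles-range _ bs))

count-singles : ∀ c (χ : ℕ → Bool) {n k} → k < n →
                count (suc (k + c)) (singles c (applyDownFrom χ n)) ≡ (if χ k then 1 else 0)
count-singles c χ {suc n} {k} k< with k ≟ n
... | yes refl = last (χ k)
  where
  bs = applyDownFrom χ k
  j = suc (k + c)
  len : length bs ≡ k
  len = length-applyDownFrom χ k
  absent : count j (singles c bs) ≡ 0
  absent = singles-large bs (s≤s (≤-reflexive (cong (_+ c) len)))
  last : ∀ b → count j (singles c (b ∷ bs)) ≡ (if b then 1 else 0)
  last false = absent
  last true  = trans (cong (λ l → count j (suc (l + c) ∷ singles c bs)) len)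
    (trans (count-≡ j (singles c bs)) (cong suc absent))
... | no k≢n = trans (next (χ n)) (count-singles c χ (≤∧≢⇒< (s≤s⁻¹ k<) k≢n))
  where
  bs = applyDownFrom χ n
  j = suc (k + c)
  next : ∀ b → count j (singles c (b ∷ bs)) ≡ count j (singles c bs)
  next false = refl
  next true  = count-≢ (λ eq → k≢n (sym (trans (sym (length-applyDownFrom χ n))
    (+-cancelʳ-≡ c _ _ (suc-injective eq))))) (singles c bs)

even-or-odd : ∀ n → 2 ∣ n ⊎ 2 ∤ n
even-or-odd n with 2 ∣? n
... | yes even = inj₁ even
... | no  odd  = inj₂ odd

2∤1+2n : ∀ n → 2 ∤ suc (2 * n)
2∤1+2n n 2∣ = contradiction (∣m+n∣m⇒∣n (subst (2 ∣_) (+-comm 1 (2 * n)) 2∣) (m∣m*n n)) (>⇒∤ (n<1+n 1))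

module _ (π : Partition) (π∈ : π ∈ A₁) where

  private
    odd-≤1        = proj₁ π∈
    odd-absent    = proj₁ (proj₂ π∈)
    even-repeated = proj₂ (proj₂ π∈)

  -- Odd parts are not repeated in 𝒜₁, and the default 0 is even as well.
  2∣largestRepeated : 2 ∣ largestRepeated π
  2∣largestRepeated with even-or-odd (largestRepeated π) | largestRepeated-attained π
  ... | inj₁ even | _         = even
  ... | inj₂ odd  | inj₁ zero′ = contradiction (subst (2 ∣_) (sym zero′) (2 ∣0)) odd
  ... | inj₂ odd  | inj₂ 2≤m  = contradiction (odd-≤1 _ odd) (<⇒≱ 2≤m)

  module _ (d : ℕ) (d≡ : largestRepeated π ≡ 2 * d) where

    private
      multiplicities : List ℕ
      multiplicities = applyUpTo (λ k → m (2 * suc k) π) d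

      presence : ℕ → Bool
      presence k = 0 <ᵇ m (suc (k + 2 * d)) π

      -- No part exceeds the size, so ∣ π ∣ positions beyond 2d record every part there.
      tail : List Bool
      tail = applyDownFrom presence ∣ π ∣

    2≤multiplicities : All (2 ≤_) multiplicities
    2≤multiplicities = All.applyUpTo⁺₁ _ d repeated
      where
      repeated : ∀ {k} → k < d → 2 ≤ m (2 * suc k) π
      repeated {k} k<d with 2 * suc k ≟ largestRepeated π | largestRepeated-attained π
      ... | no  ≢L | _ = even-repeated _ (m∣m*n (suc k)) z<s
        (≤∧≢⇒< (≤-trans (*-monoʳ-≤ 2 k<d) (≤-reflexive (sym d≡))) ≢L)
      -- 𝒜₁ speaks of even values strictly below R₁; R₁ = 2d itself is repeated because a nonzero
      -- maximum is attained.
      ... | yes ≡L | inj₁ zero′ = contradiction (trans ≡L zero′) λ ()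
      ... | yes ≡L | inj₂ 2≤m   = subst (λ j → 2 ≤ m j π) (sym ≡L) 2≤m

    m≤1-above : ∀ {j} → 2 * d < j → m j π ≤ 1
    m≤1-above 2d<j = ≮⇒≥ λ 2≤m → <⇒≱ 2d<j (≤-trans (≤-largestRepeated π 2≤m) (≤-reflexive d≡))

    count-tail : ∀ k → count (suc (k + 2 * d)) (singles (2 * d) tail) ≡ m (suc (k + 2 * d)) π
    count-tail k with k <? ∣ π ∣
    ... | yes k< = trans (count-singles (2 * d) presence k<) (bit (m≤1-above (s≤s (m≤n+m (2 * d) k))))
      where
      bit : ∀ {n} → n ≤ 1 → (if 0 <ᵇ n then 1 else 0) ≡ n
      bit z≤n       = refl
      bit (s≤s z≤n) = refl
    ... | no  k≮ = trans
      (singles-large tail (s≤s (+-monoˡ-≤ (2 * d)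
        (≤-trans (≤-reflexive (length-applyDownFrom presence ∣ π ∣)) (≮⇒≥ k≮)))))
      (sym (m-above-size π (s≤s (≤-trans (≮⇒≥ k≮) (m≤m+n k (2 * d))))))

    count-multiplicities : ∀ j → j ≤ 2 * d → count j (evens 0 multiplicities) ≡ m j π
    count-multiplicities j j≤ with even-or-odd j
    ... | inj₂ odd = trans (evens-odd multiplicities odd)
      (sym (odd-absent j odd (≤-<-trans j≤ (subst (λ L → 2 * d < L + 2) (sym d≡) (m<m+n (2 * d) z<s)))))
    ... | inj₁ (divides zero refl) = trans
      (count-absent (All.map (λ (_ , lower , _) → ≢-sym (<⇒≢ lower)) (evens-range 0 multiplicities)))
      (sym (count-absent (All.map (≢-sym ∘ <⇒≢) (positive π))))
    ... | inj₁ (divides (suc k) refl) = subst (λ i → count i (evens 0 multiplicities) ≡ m i π) (*-comm 2 (suc k))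
      (trans (count-evens 0 multiplicities k) (nth-applyUpTo (λ k → m (2 * suc k) π) {d}
        (*-cancelˡ-≤ 2 (≤-trans (≤-reflexive (*-comm 2 (suc k))) j≤))))

    -- The bound R₁ + 2 in 𝒜₁ reaches just far enough to exclude the odd value 2d + 1.
    tail-above : All (suc (2 * d) <_) (singles (2 * d) tail)
    tail-above = above _ (All.map proj₁ (singles-range (2 * d) tail)) (trans (count-tail 0)
      (odd-absent _ (2∤1+2n d) (subst (λ L → suc (2 * d) < L + 2) (sym d≡) (≤-reflexive (+-comm 2 (2 * d))))))

    multiplicities-image : evens 0 multiplicities ++ singles (2 * d) tail ↭ parts π
    multiplicities-image = counts⇒↭ _ _ λ j → trans (count-++ j (evens 0 multiplicities) _) (counts j)
      where
      counts : ∀ j → count j (evens 0 multiplicities) + count j (singles (2 * d) tail) ≡ m j π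
      counts j with j ≤? 2 * d
      ... | yes j≤ = trans (cong₂ _+_ (count-multiplicities j j≤) (singles-small tail j≤)) (+-identityʳ _)
      ... | no  j≰ = cong₂ _+_
        (evens-large multiplicities (subst (λ n → 2 * n < j) (sym (length-applyUpTo _ d)) (≰⇒> j≰)))
        (subst (λ i → count i (singles (2 * d) tail) ≡ m i π)
          (trans (sym (+-suc (j ∸ suc (2 * d)) (2 * d))) (m∸n+n≡m (≰⇒> j≰)))
          (count-tail (j ∸ suc (2 * d))))

    preimage-word : Σ[ w ∈ Word ] All (1 <_) (values w) × image w ↭ parts π
    preimage-word =
      let w , es , ss = realize 2≤multiplicities tail
          d′ = trans (cong length es) (length-applyUpTo _ d)
      in w , values-above (2 * d) w (subst (All (suc (2 * d) <_)) (sym (ss (2 * d))) tail-above) ,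
         subst (_↭ parts π)
           (sym (cong₂ _++_ (cong (evens 0) es) (trans (cong (λ n → singles (2 * n) (bits w)) d′) (ss (2 * d)))))
           multiplicities-image

  f-preimage : Σ[ π′ ∈ Partition ] π′ ∈ G₁ × f π′ ≡ π
  f-preimage =
    let divides d d≡ = 2∣largestRepeated
        w , 1< , p = preimage-word d (trans d≡ (*-comm d 2))
    in fromWord w , fromWord∈G₁ w 1< , partition-↭ (↭-trans (f-image (fromWord w) w refl) p)

theorem3 : RestrictsToBijection f G₁ A₁ × (∀ π → π ∈ G₂ → ∣ f π ∣ ≡ ∣ π ∣)
theorem3 =
  ( (λ {π} → f-maps {π})
  , (λ { {π , π∈} {π′ , π′∈} → f-injective {π} {π′} π∈ π′∈ })
  , λ { (λ′ , λ′∈) → let π , π∈ , eq = f-preimage λ′ λ′∈ in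
        (π , π∈) , λ { refl → eq } } )
  , size-f
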